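{- There exists a family of broadcast protocols $(P_n)_{n}$, $P_n=(Q_n,I_n,M_n,\Delta_n)$, with target sets $F_n\subseteq Q_n$, such that for every $n$: there exists a reconfigurable execution of $P_n$ covering $F_n$ with $3$ nodes; and every lossy execution of $P_n$ covering $F_n$ has $\Omega(n)$ nodes.
   Context: A broadcast protocol is a tuple $P=(Q,I,M,\Delta)$ where $Q$ is a finite set of states, $I\subseteq Q$ initial states, $M$ a finite message alphabet and $\Delta\subseteq Q\times\{!!m,\ ??m \mid m\in M\}\times Q$ ($!!m$ = broadcast, $??m$ = reception); protocols are complete for receptions (for every $q$, $m$ there is $q'$ with $(q,??m,q')\in\Delta$). A configuration is a finite undirected graph $\gamma=(V,E,L)$, $E$ symmetric irreflexive, $L:V\to Q$; initial if $L(V)\subseteq I$. A reconfigurable step from $(V,E,L)$ to $(V,E',L')$ ($E'$ arbitrary): some node $v$ and $m$ with $(L(v),!!m,L'(v))\in\Delta$, every neighbour $v'$ of $v$ in $E$ satisfies $(L(v'),??m,L'(v'))\in\Delta$, every other node keeps its label. A lossy step from $(V,E,L)$ to $(V,E,L')$ (edges fixed): some $v$, $m$ with $(L(v),!!m,L'(v))\in\Delta$ and either all other nodes keep their labels (lost broadcast) or as in the reconfigurable step with $E$ (successful broadcast). A reconfigurable (resp. lossy) execution is a sequence $\gamma_0,\dots,\gamma_r$ with $\gamma_0$ initial and consecutive reconfigurable (resp. lossy) steps; its number of nodes is $|V|$, and it covers $F$ if some node of $\gamma_r$ has a label in $F$. -}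

module Defs where

open import Data.Fin using (Fin)
open import Data.Nat using (ℕ; _≤_; _*_)
open import Data.Product using (_×_; _,_; ∃-syntax)
open import Data.Sum using (_⊎_)
open import Function.Bundles using (_↔_)
open import Level using (Level; 0ℓ)
open import Relation.Binary.Construct.Closure.ReflexiveTransitive using (Star)
open import Relation.Binary.Core using (Rel; _⇔_)
import Relation.Binary.Definitions as B
open import Relation.Binary.PropositionalEquality using (_≡_; _≢_)
open import Relation.Nullary using (¬_)
open import Relation.Unary using (Pred; Decidable; _∈_)

-- Finite sets are types in bijection with some Fin k, and their subsets are
-- decidable predicates.  (Classically every subset is decidable.)

Finite : Set → Set
Finite A = ∃[ k ] (A ↔ Fin k)

data Action (M : Set) : Set where
  !!_ : M → Action M
  ??_ : M → Action M

record Protocol : Set₁ where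
  field
    Q        : Set
    Q-finite : Finite Q
    M        : Set
    M-finite : Finite M
    I        : Pred Q 0ℓ
    I?       : Decidable I
    Δ        : Pred (Q × Action M × Q) 0ℓ
    Δ?       : Decidable Δ
    complete : ∀ q m → ∃[ q′ ] (q , ?? m , q′) ∈ Δ

module _ (P : Protocol) where
  open Protocol P

  -- The node set V with |V| = N is Fin N.
  record Configuration (N : ℕ) : Set₁ where
    field
      E        : Rel (Fin N) 0ℓ
      E?       : B.Decidable E
      E-sym    : B.Symmetric E
      E-irrefl : B.Irreflexive _≡_ E
      L        : Fin N → Q

  open Configuration

  Initial : ∀ {N} → Configuration N → Set
  Initial γ = ∀ v → L γ v ∈ I

  Covering : ∀ {N} → Pred Q 0ℓ → Configuration N → Set
  Covering F γ = ∃[ v ] L γ v ∈ F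

  module _ {N : ℕ} where

    Broadcasts : Fin N → M → Rel (Configuration N) 0ℓ
    Broadcasts v m γ γ′ = (L γ v , !! m , L γ′ v) ∈ Δ

    -- Reception along the edges of the source configuration γ.
    Received : Fin N → M → Rel (Configuration N) 0ℓ
    Received v m γ γ′ =
      (∀ v′ → E γ v v′ → (L γ v′ , ?? m , L γ′ v′) ∈ Δ) ×
      (∀ v′ → v′ ≢ v → ¬ E γ v v′ → L γ′ v′ ≡ L γ v′)

    Lost : Fin N → Rel (Configuration N) 0ℓ
    Lost v γ γ′ = ∀ v′ → v′ ≢ v → L γ′ v′ ≡ L γ v′

    -- The edges of γ′ are unconstrained.
    ReconfigurableStep : Rel (Configuration N) 0ℓ
    ReconfigurableStep γ γ′ =
      ∃[ v ] ∃[ m ] Broadcasts v m γ γ′ × Received v m γ γ′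

    LossyStep : Rel (Configuration N) 0ℓ
    LossyStep γ γ′ =
      (E γ ⇔ E γ′) ×
      (∃[ v ] ∃[ m ] Broadcasts v m γ γ′ × (Lost v γ γ′ ⊎ Received v m γ γ′))

  record CoveringExecution (F : Pred Q 0ℓ) (N : ℕ)
                           (Step : Rel (Configuration N) 0ℓ) : Set₁ where
    field
      γ₀ γᵣ    : Configuration N
      initial  : Initial γ₀
      steps    : Star Step γ₀ γᵣ
      covering : Covering F γᵣ

  ReconfigurableCovering : Pred Q 0ℓ → ℕ → Set₁
  ReconfigurableCovering F N = CoveringExecution F N ReconfigurableStep

  LossyCovering : Pred Q 0ℓ → ℕ → Set₁
  LossyCovering F N = CoveringExecution F N LossyStep

-- Every N with R n N is Ω(n), the constants being uniform in n and N:
-- N ≥ n / c for all n ≥ n₀.  A positive real constant can always be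
-- decreased to one of the form 1 / c; c = 0 would only say more.
AllΩ : ∀ {ℓ : Level} → (ℕ → ℕ → Set ℓ) → Set ℓ
AllΩ R = ∃[ c ] ∃[ n₀ ] (∀ n → n₀ ≤ n → ∀ N → R n N → n ≤ c * N)

{-# OPTIONS --safe #-}
-- A seeker must complete n rounds.  In round j it calls, and must then hear a
-- reply of round j from a responder that heard a call of round j; a responder
-- that replied in round j dies if it hears a call of round at most j + 1.  With
-- reconfigurable edges two responders can serve alternate rounds, each
-- disconnected from the seeker when a call would kill it.  With fixed edges,
-- the caller of the first call of round j + 1 that is not lost has a neighbour
-- that replied in round j, and this neighbour is dead after the call.  As dead
-- responders remember their round, n rounds require n distinct responders.
module Submission where

open import Defs
open import Data.Fin using (Fin; zero; suc; toℕ; fromℕ; inject₁)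
open import Data.Fin.Induction using (<-weakInduction)
open import Data.Fin.Patterns using (0F; 1F; 2F)
open import Data.Fin.Properties
  using (_≟_; toℕ<n; toℕ-fromℕ; toℕ-inject₁; toℕ-injective; +↔⊎; inj⇒≟; injective⇒≤)
open import Data.Nat using (ℕ; _≤_; _<_; s≤s⁻¹; _≤?_)
open import Data.Nat.Properties
  using (≤-refl; ≤-reflexive; ≤-trans; <-≤-trans; <⇒≱; ≰⇒≥; m≤n⇒m<n∨m≡n; *-identityˡ)
open import Data.Product using (_×_; _,_; proj₁; proj₂; ∃-syntax; Σ-syntax)
open import Data.Sum using (_⊎_; inj₁; inj₂; [_,_])
open import Data.Sum.Function.Propositional using (_⊎-↔_)
open import Data.Unit using (⊤)
open import Data.Vec.Functional using (Vector; updateAt; []; _∷_)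
open import Data.Vec.Functional.Properties using (updateAt-updates; updateAt-minimal)
open import Function using (_∘_; id; const)
open import Function.Construct.Composition using (_↔-∘_)
open import Function.Construct.Identity using (↔-id)
open import Function.Construct.Symmetry using (↔-sym)
open import Function.Properties.Inverse using (↔⇒↣)
open import Level using (0ℓ)
open import Relation.Binary.Construct.Closure.ReflexiveTransitive using (Star; ε; _◅_; _◅◅_)
open import Relation.Binary.Definitions using (DecidableEquality)
open import Relation.Binary.PropositionalEquality
  using (_≡_; _≢_; refl; sym; trans; cong; subst; ≢-sym)
open import Relation.Nullary using (yes; no; contradiction)
open import Relation.Nullary.Decidable using (_×-dec_; _⊎-dec_)
open import Relation.Unary using (Pred; Decidable; _∈_)

private variable
  n N : ℕ

-- Finite types and the protocol

Fin-finite : Finite (Fin n)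
Fin-finite = _ , ↔-id _

⊎-finite : ∀ {A B} → Finite A → Finite B → Finite (A ⊎ B)
⊎-finite (_ , A↔) (_ , B↔) = _ , ↔-sym +↔⊎ ↔-∘ (A↔ ⊎-↔ B↔)

finite⇒≟ : ∀ {A} → Finite A → DecidableEquality A
finite⇒≟ (_ , A↔) = inj⇒≟ (↔⇒↣ A↔)

-- A sum of `Fin`s, so that finiteness and decidable equality follow from closure of `Finite` under
-- sums.
State : ℕ → Set
State n = Fin (ℕ.suc n) ⊎ Fin n ⊎ Fin 1 ⊎ Fin n ⊎ Fin n ⊎ Fin n

-- Seekers are seeking or waiting, responders are in one of the other states.
pattern seeking k = inj₁ k
pattern waiting j = inj₂ (inj₁ j)
pattern idle      = inj₂ (inj₂ (inj₁ 0F))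
pattern alerted j = inj₂ (inj₂ (inj₂ (inj₁ j)))
pattern spent j   = inj₂ (inj₂ (inj₂ (inj₂ (inj₁ j))))
pattern dead j    = inj₂ (inj₂ (inj₂ (inj₂ (inj₂ j))))

Message : ℕ → Set
Message n = Fin n ⊎ Fin n

pattern call j  = inj₁ j
pattern reply j = inj₂ j

State-finite : Finite (State n)
State-finite =
  ⊎-finite Fin-finite (⊎-finite Fin-finite (⊎-finite Fin-finite
    (⊎-finite Fin-finite (⊎-finite Fin-finite Fin-finite))))

_≟ˢ_ : DecidableEquality (State n)
_≟ˢ_ = finite⇒≟ State-finite

source target : Message n → State n
source (call j)  = seeking (inject₁ j)
source (reply j) = alerted j
target (call j)  = waiting j
target (reply j) = spent j

receive : State n → Message n → State n
receive (waiting i) (reply j) with i ≟ j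
... | yes _ = seeking (suc i)
... | no _  = waiting i
-- The bound includes `i + 1`, so the call that follows the reply of round `i` is lethal. Calls of
-- older rounds are lethal too: reviving the node would replace its memory of round `i` by an older
-- round.
receive (spent i) (call j) with toℕ j ≤? ℕ.suc (toℕ i)
... | yes _ = dead i
... | no _  = alerted j
receive idle (call j) = alerted j
receive q _ = q

Initially : Pred (State n) 0ℓ
Initially q = q ≡ seeking zero ⊎ q ≡ idle

Transition : Pred (State n × Action (Message n) × State n) 0ℓ
Transition (q , !! m , q′) = q ≡ source m × q′ ≡ target m
Transition (q , ?? m , q′) = q′ ≡ receive q m

transition? : Decidable (Transition {n})
transition? (q , !! m , q′) = (q ≟ˢ source m) ×-dec (q′ ≟ˢ target m)
transition? (q , ?? m , q′) = q′ ≟ˢ receive q m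

protocol : ℕ → Protocol
protocol n = record
  { Q        = State n
  ; Q-finite = State-finite
  ; M        = Message n
  ; M-finite = ⊎-finite Fin-finite Fin-finite
  ; I        = Initially
  ; I?       = λ q → (q ≟ˢ seeking zero) ⊎-dec (q ≟ˢ idle)
  ; Δ        = Transition
  ; Δ?       = transition?
  ; complete = λ q m → receive q m , refl
  }

Goal : ∀ n → Pred (State n) 0ℓ
Goal n q = q ≡ seeking (fromℕ n)

Network : ℕ → ℕ → Set₁
Network n = Configuration (protocol n)

open Configuration

-- Reconfigurable coverings

receive-waiting : (j : Fin n) → receive (waiting j) (reply j) ≡ seeking (suc j)
receive-waiting j with j ≟ j
... | yes _  = refl
... | no j≢j = contradiction refl j≢j

receive-spent-≤ : {i j : Fin n} → toℕ j ≤ ℕ.suc (toℕ i) → receive (spent i) (call j) ≡ dead i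
receive-spent-≤ {i = i} {j} j≤1+i with toℕ j ≤? ℕ.suc (toℕ i)
... | yes _    = refl
... | no j≰1+i = contradiction j≤1+i j≰1+i

-- The threshold is a natural number because after the last round it exceeds every index in `Fin n`.
Callable : ℕ → Pred (State n) 0ℓ
Callable t q = ∀ j → t ≤ toℕ j → receive q (call j) ≡ alerted j

spent-callable : (i : Fin n) → Callable (ℕ.suc (ℕ.suc (toℕ i))) (spent i)
spent-callable i j i+2≤j with toℕ j ≤? ℕ.suc (toℕ i)
... | yes j≤i+1 = contradiction j≤i+1 (<⇒≱ i+2≤j)
... | no _      = refl

-- With a single edge, every node off that edge is out of earshot.
link : {v w : Fin N} → v ≢ w → Vector (State n) N → Network n N
link {v = v} {w} v≢w L = record
  { E        = λ x y → (x ≡ v × y ≡ w) ⊎ (x ≡ w × y ≡ v)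
  ; E?       = λ x y → ((x ≟ v) ×-dec (y ≟ w)) ⊎-dec ((x ≟ w) ×-dec (y ≟ v))
  ; E-sym    = [ (λ (p , q) → inj₂ (q , p)) , (λ (p , q) → inj₁ (q , p)) ]
  ; E-irrefl = λ { refl (inj₁ (p , q)) → v≢w (trans (sym p) q)
                 ; refl (inj₂ (p , q)) → v≢w (trans (sym q) p) }
  ; L        = L
  }

exchange : Message n → Fin N → Fin N → Vector (State n) N → Vector (State n) N
exchange m v w L = updateAt (updateAt L v (const (target m))) w (const (receive (L w) m))

module _ (m : Message n) {v w : Fin N} (v≢w : v ≢ w) (L : Vector (State n) N) where

  exchange-sender : exchange m v w L v ≡ target m
  exchange-sender = trans (updateAt-minimal v w _ v≢w) (updateAt-updates v L)

  exchange-receiver : exchange m v w L w ≡ receive (L w) m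
  exchange-receiver = updateAt-updates w _

  exchange-other : ∀ {x} → x ≢ v → x ≢ w → exchange m v w L x ≡ L x
  exchange-other {x} x≢v x≢w = trans (updateAt-minimal x w _ x≢w) (updateAt-minimal x v L x≢v)

  transmit : L v ≡ source m → {x y : Fin N} (x≢y : x ≢ y) →
             ReconfigurableStep (protocol n) (link v≢w L) (link x≢y (exchange m v w L))
  transmit Lv x≢y = v , m , (Lv , exchange-sender) ,
    (λ { _ (inj₁ (_ , refl)) → exchange-receiver
       ; _ (inj₂ (v≡w , _))  → contradiction v≡w v≢w }) ,
    (λ u u≢v ¬vu → exchange-other u≢v λ { refl → ¬vu (inj₁ (refl , refl)) })

round : ∀ (j : Fin n) {s y z : Fin N} (s≢y : s ≢ y) (s≢z : s ≢ z) → y ≢ z →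
        (L : Vector (State n) N) → L s ≡ seeking (inject₁ j) → L y ∈ Callable (toℕ j) →
        ∃[ L′ ] Star (ReconfigurableStep (protocol n)) (link s≢y L) (link s≢z L′) ×
                L′ s ≡ seeking (suc j) × L′ y ≡ spent j × L′ z ≡ L z
round j {s} {y} {z} s≢y s≢z y≢z L Ls callable =
  L₂ ,
  -- Call and reply use the same edge, written sender first. Only the second step moves the edge,
  -- joining `s` to the next responder `z`.
  _◅_ {j = link y≢s L₁} (transmit (call j) s≢y L Ls y≢s) (transmit (reply j) y≢s L₁ L₁y s≢z ◅ ε) ,
  trans (exchange-receiver (reply j) y≢s L₁)
    (trans (cong (λ q → receive q (reply j)) (exchange-sender (call j) s≢y L)) (receive-waiting j)) ,
  exchange-sender (reply j) y≢s L₁ ,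
  trans (exchange-other (reply j) y≢s L₁ z≢y z≢s) (exchange-other (call j) s≢y L z≢s z≢y)
  where
  y≢s = ≢-sym s≢y
  z≢s = ≢-sym s≢z
  z≢y = ≢-sym y≢z
  L₁  = exchange (call j) s y L
  L₂  = exchange (reply j) y s L₁
  L₁y : L₁ y ≡ alerted j
  L₁y = trans (exchange-receiver (call j) s≢y L) (callable j ≤-refl)

start : Vector (State n) 3
start = seeking zero ∷ idle ∷ idle ∷ []

0≢1 : _≢_ {A = Fin 3} 0F 1F
0≢1 ()

-- Node `0F` is the seeker, `y` its neighbour that can serve round `k`, and `z` the responder held
-- back for the round after.
Reached : ∀ n → Fin (ℕ.suc n) → Set₁
Reached n k =
  Σ[ y ∈ Fin 3 ] Σ[ z ∈ Fin 3 ] Σ[ 0≢y ∈ 0F ≢ y ] 0F ≢ z × y ≢ z × Σ[ L ∈ Vector (State n) 3 ]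
    Star (ReconfigurableStep (protocol n)) (link 0≢1 start) (link 0≢y L) ×
    L 0F ≡ seeking k × L y ∈ Callable (toℕ k) × L z ∈ Callable (ℕ.suc (toℕ k))

reached : ∀ n k → Reached n k
reached n = <-weakInduction (Reached n)
  (1F , 2F , 0≢1 , (λ ()) , (λ ()) , start , ε , refl , (λ _ _ → refl) , (λ _ _ → refl))
  next
  where
  next : ∀ j → Reached n (inject₁ j) → Reached n (suc j)
  next j (y , z , 0≢y , 0≢z , y≢z , L , steps , L0 , y-callable , z-callable)
    rewrite toℕ-inject₁ j
    with L′ , steps′ , L′0 , L′y , L′z ← round j 0≢y 0≢z y≢z L L0 y-callable =
    -- The responders swap roles: `z` is callable from round `j + 1` on, and `y`, having just
    -- replied, from round `j + 2` on.
    z , y , 0≢z , 0≢y , ≢-sym y≢z , L′ , steps ◅◅ steps′ , L′0 ,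
    subst (Callable _) (sym L′z) z-callable ,
    subst (Callable _) (sym L′y) (spent-callable j)

reconfigurableCovering : ∀ n → ReconfigurableCovering (protocol n) (Goal n) 3
reconfigurableCovering n
  with _ , _ , _ , _ , _ , _ , steps , L0 , _ ← reached n (fromℕ n) = record
  { initial  = λ { 0F → inj₁ refl ; 1F → inj₂ refl ; 2F → inj₂ refl }
  ; steps    = steps
  ; covering = 0F , L0
  }

-- Lossy coverings

module _ {n N : ℕ} where

  DeadBelow : ℕ → Network n N → Set
  DeadBelow t γ = ∀ i → toℕ i < t → ∃[ w ] L γ w ≡ dead i

  -- The second case arises when a reply is heard: the last round is recorded only by a neighbour
  -- still `spent`, which the next call of `v` kills unless it is lost.
  Backed : Fin N → ℕ → Network n N → Set
  Backed v t γ =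
    DeadBelow t γ ⊎ (∃[ w ] ∃[ i ] E γ v w × L γ w ≡ spent i × t ≡ ℕ.suc (toℕ i))

  -- A responder takes its round from a call that was heard, which has killed any backing neighbour;
  -- hence `DeadBelow` outright. The call of a waiting seeker may have been lost, hence only
  -- `Backed`.
  Sound : Network n N → Fin N → State n → Set
  Sound γ v (seeking k) = Backed v (toℕ k) γ
  Sound γ v (waiting j) = Backed v (toℕ j) γ
  Sound γ v idle        = ⊤
  Sound γ v (alerted j) = DeadBelow (toℕ j) γ
  Sound γ v (spent j)   = DeadBelow (toℕ j) γ
  Sound γ v (dead j)    = DeadBelow (toℕ j) γ

  Invariant : Network n N → Set
  Invariant γ = ∀ v → Sound γ v (L γ v)

  DeadBelow-≤ : ∀ {s t} γ → s ≤ t → DeadBelow t γ → DeadBelow s γ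
  DeadBelow-≤ γ s≤t below i i<s = below i (<-≤-trans i<s s≤t)

  DeadBelow-suc : ∀ γ {w} i → L γ w ≡ dead i → DeadBelow (toℕ i) γ → DeadBelow (ℕ.suc (toℕ i)) γ
  DeadBelow-suc γ i Lw below l l≤i with m≤n⇒m<n∨m≡n (s≤s⁻¹ l≤i)
  ... | inj₁ l<i = below l l<i
  ... | inj₂ l≡i = _ , trans Lw (cong dead′ (sym (toℕ-injective l≡i)))
    where
    dead′ : Fin n → State n
    dead′ j = dead j

  initial-invariant : ∀ {γ} → Initial (protocol n) γ → Invariant γ
  initial-invariant {γ} init v with L γ v | init v
  ... | _ | inj₁ refl = inj₁ λ _ ()
  ... | _ | inj₂ refl = _

  -- Preservation of the invariant by a lossy step

  Heard : Fin N → Message n → Network n N → Network n N → Set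
  Heard v m γ γ′ = ∀ w → E γ v w → L γ′ w ≡ receive (L γ w) m

  module Preservation {γ γ′ : Network n N}
    (E⇒E′ : ∀ {x y} → E γ x y → E γ′ x y) (inv : Invariant γ)
    {v : Fin N} (m : Message n) (Lv : L γ v ≡ source m) (L′v : L γ′ v ≡ target m)
    -- This covers lost and successful broadcasts alike. A node that receives also witnesses that
    -- all other neighbours of `v` received.
    (fate : ∀ w → w ≢ v → L γ′ w ≡ L γ w ⊎ Heard v m γ γ′ × E γ v w)
    where

    nonsource-fate : ∀ {w q} → L γ w ≡ q → q ≢ source m →
                     L γ′ w ≡ q ⊎ Heard v m γ γ′ × L γ′ w ≡ receive q m
    nonsource-fate {w} refl q≢ with fate w (λ { refl → q≢ Lv })
    ... | inj₁ kept          = inj₁ kept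
    ... | inj₂ (heard , vw)  = inj₂ (heard , heard w vw)

    dead-stays : ∀ {w i} → L γ w ≡ dead i → L γ′ w ≡ dead i
    dead-stays Lw = [ id , proj₂ ] (nonsource-fate Lw (dead≢source m))
      where
      dead≢source : ∀ {i} (m : Message n) → dead i ≢ source m
      dead≢source (call _)  ()
      dead≢source (reply _) ()

    DeadBelow-mono : ∀ {t} → DeadBelow t γ → DeadBelow t γ′
    DeadBelow-mono below i i<t with w , Lw ← below i i<t = w , dead-stays Lw

    spent-below : ∀ {w i} → L γ w ≡ spent i → DeadBelow (toℕ i) γ′
    spent-below {w} Lw = DeadBelow-mono (subst (Sound γ w) Lw (inv w))

    -- If the caller is backed by a spent neighbour, that neighbour replied in round `j - 1`, hears
    -- this call too and dies, which completes the record.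
    call-below : ∀ {j} → m ≡ call j → Heard v m γ γ′ → DeadBelow (toℕ j) γ′
    call-below {j} refl heard
      with subst (λ t → Backed v t γ) (toℕ-inject₁ j) (subst (Sound γ v) Lv (inv v))
    ... | inj₁ below                      = DeadBelow-mono below
    ... | inj₂ (w , i , vw , Lw , j≡1+i) = subst (λ t → DeadBelow t γ′) (sym j≡1+i)
      (DeadBelow-suc γ′ i (trans (heard w vw) (trans (cong (λ q → receive q (call j)) Lw)
                                                  (receive-spent-≤ (≤-reflexive j≡1+i))))
                       (spent-below Lw))

    spent-fate : ∀ {w i} → L γ w ≡ spent i → L γ′ w ≡ spent i ⊎ DeadBelow (ℕ.suc (toℕ i)) γ′
    spent-fate {w} {i} Lw = go m refl (nonsource-fate Lw (spent≢source m))
      where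
      spent≢source : ∀ {i} (m : Message n) → spent i ≢ source m
      spent≢source (call _)  ()
      spent≢source (reply _) ()
      go : ∀ m′ → m ≡ m′ → L γ′ w ≡ spent i ⊎ Heard v m γ γ′ × L γ′ w ≡ receive (spent i) m′ →
           L γ′ w ≡ spent i ⊎ DeadBelow (ℕ.suc (toℕ i)) γ′
      go m′        m≡m′ (inj₁ kept)          = inj₁ kept
      go (reply _) m≡m′ (inj₂ (_ , kept))    = inj₁ kept
      go (call j)  m≡m′ (inj₂ (heard , L′w)) with toℕ j ≤? ℕ.suc (toℕ i)
      ... | yes _    = inj₂ (DeadBelow-suc γ′ i L′w (spent-below Lw))
      -- The revived node forgets round `i`, but a call of a round beyond `i + 1` was heard, so dead
      -- nodes already record round `i`.
      ... | no j≰1+i = inj₂ (DeadBelow-≤ γ′ (≰⇒≥ j≰1+i) (call-below m≡m′ heard))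

    Backed-mono : ∀ {x t} → Backed x t γ → Backed x t γ′
    Backed-mono (inj₁ below) = inj₁ (DeadBelow-mono below)
    Backed-mono (inj₂ (w , i , xw , Lw , refl)) with spent-fate Lw
    -- The backing neighbour is still adjacent because lossy steps fix the edges.
    ... | inj₁ L′w   = inj₂ (w , i , E⇒E′ xw , L′w , refl)
    ... | inj₂ below = inj₁ below

    Sound-mono : ∀ {x} q → Sound γ x q → Sound γ′ x q
    Sound-mono (seeking _) = Backed-mono
    Sound-mono (waiting _) = Backed-mono
    Sound-mono idle        = id
    Sound-mono (alerted _) = DeadBelow-mono
    Sound-mono (spent _)   = DeadBelow-mono
    Sound-mono (dead _)    = DeadBelow-mono

    Sound-target : ∀ m′ → Sound γ v (source m′) → Sound γ′ v (target m′)
    Sound-target (call j)  = subst (λ t → Backed v t γ′) (toℕ-inject₁ j) ∘ Backed-mono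
    Sound-target (reply _) = DeadBelow-mono

    Sound-receive : Heard v m γ γ′ → ∀ {w} → E γ v w →
                    ∀ q m′ → m ≡ m′ → Sound γ w q → Sound γ′ w (receive q m′)
    Sound-receive heard vw (waiting i) (reply j) refl sound with i ≟ j
    -- The replier, now `spent i`, becomes the neighbour backing the seeker.
    ... | yes refl = inj₂ (v , i , E⇒E′ (E-sym γ vw) , L′v , refl)
    ... | no _     = Backed-mono sound
    Sound-receive heard vw (spent i) (call j) m≡m′ sound with toℕ j ≤? ℕ.suc (toℕ i)
    ... | yes _ = DeadBelow-mono sound
    ... | no _  = call-below m≡m′ heard
    Sound-receive heard     vw idle          (call _)  m≡m′ _     = call-below m≡m′ heard
    Sound-receive heard {w} vw q@(seeking _) _         _    sound = Sound-mono {w} q sound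
    Sound-receive heard {w} vw q@(waiting _) (call _)  _    sound = Sound-mono {w} q sound
    Sound-receive heard     vw idle          (reply _) _    _     = _
    Sound-receive heard {w} vw q@(alerted _) _         _    sound = Sound-mono {w} q sound
    Sound-receive heard {w} vw q@(spent _)   (reply _) _    sound = Sound-mono {w} q sound
    Sound-receive heard {w} vw q@(dead _)    _         _    sound = Sound-mono {w} q sound

    preserved : Invariant γ′
    preserved w with w ≟ v
    ... | yes refl = subst (Sound γ′ v) (sym L′v) (Sound-target m (subst (Sound γ v) Lv (inv v)))
    ... | no w≢v with fate w w≢v
    ...   | inj₁ kept         = subst (Sound γ′ w) (sym kept) (Sound-mono (L γ w) (inv w))
    ...   | inj₂ (heard , vw) =
      subst (Sound γ′ w) (sym (heard w vw)) (Sound-receive heard vw (L γ w) m refl (inv w))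

  step-preserves : ∀ {γ γ′} → LossyStep (protocol n) γ γ′ → Invariant γ → Invariant γ′
  step-preserves {γ} {γ′} ((E⇒E′ , _) , v , m , (Lv , L′v) , outcome) inv =
    Preservation.preserved E⇒E′ inv m Lv L′v (fate outcome)
    where
    fate : Lost (protocol n) v γ γ′ ⊎ Received (protocol n) v m γ γ′ →
           ∀ w → w ≢ v → L γ′ w ≡ L γ w ⊎ Heard v m γ γ′ × E γ v w
    fate (inj₁ lost)            w w≢v = inj₁ (lost w w≢v)
    fate (inj₂ (heard , other)) w w≢v with E? γ v w
    ... | yes vw = inj₂ (heard , vw)
    ... | no ¬vw = inj₁ (other w w≢v ¬vw)

  steps-preserve : ∀ {γ γ′} → Star (LossyStep (protocol n)) γ γ′ → Invariant γ → Invariant γ′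
  steps-preserve ε              = id
  steps-preserve (step ◅ steps) = steps-preserve steps ∘ step-preserves step

  -- Counting responders

  Replied : Fin n → Pred (State n) 0ℓ
  Replied i q = q ≡ spent i ⊎ q ≡ dead i

  Replied-unique : ∀ {i j q} → q ∈ Replied i → q ∈ Replied j → i ≡ j
  Replied-unique (inj₁ refl) (inj₁ refl) = refl
  Replied-unique (inj₂ refl) (inj₂ refl) = refl

  -- A spent backing neighbour accounts for the last round itself, and its own soundness for all
  -- earlier ones.
  backed-replied : ∀ {γ v t} → Invariant γ → Backed v t γ →
                   ∀ i → toℕ i < t → ∃[ w ] L γ w ∈ Replied i
  backed-replied inv (inj₁ below) i i<t with w , Lw ← below i i<t = w , inj₂ Lw
  backed-replied {γ} inv (inj₂ (w , j , _ , Lw , refl)) i i≤j with m≤n⇒m<n∨m≡n (s≤s⁻¹ i≤j)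
  ... | inj₁ i<j with x , Lx ← subst (Sound γ w) Lw (inv w) i i<j = x , inj₂ Lx
  ... | inj₂ i≡j with refl ← toℕ-injective i≡j = w , inj₁ Lw

  lossyCovering⇒≤ : LossyCovering (protocol n) (Goal n) N → n ≤ N
  lossyCovering⇒≤ record { γᵣ = γ ; initial = init ; steps = steps ; covering = v , Lv } =
    -- A node remembers only one round, so choosing a responder for each round is injective.
    injective⇒≤ {f = proj₁ ∘ responder} λ {i} {j} eq →
      Replied-unique (proj₂ (responder i))
        (subst (λ w → L γ w ∈ Replied j) (sym eq) (proj₂ (responder j)))
    where
    inv : Invariant γ
    inv = steps-preserve steps (initial-invariant init)
    responder : ∀ i → ∃[ w ] L γ w ∈ Replied i
    responder i = backed-replied inv
      (subst (λ t → Backed v t γ) (toℕ-fromℕ n) (subst (Sound γ v) Lv (inv v))) i (toℕ<n i)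

theorem4p1 : Σ[ P ∈ (ℕ → Protocol) ]
    Σ[ F ∈ ((n : ℕ) → Pred (Protocol.Q (P n)) 0ℓ) ]
    ((n : ℕ) → Decidable (F n)) ×
    ((n : ℕ) → ReconfigurableCovering (P n) (F n) 3) ×
    AllΩ (λ n N → LossyCovering (P n) (F n) N)
theorem4p1 =
  protocol , Goal , (λ n q → q ≟ˢ seeking (fromℕ n)) , reconfigurableCovering ,
  -- The bound is `n ≤ N` for every `n`, hence the constants 1 and 0.
  1 , 0 , λ n _ N covering → ≤-trans (lossyCovering⇒≤ covering) (≤-reflexive (sym (*-identityˡ N)))
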